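{- Let $\{D_i\}_{i\ge 1}$ be a set of (finite, loopless) digraphs such that $|V(D_i)| = i$ for each $i$ and such that the undirected graph underlying $D_i$ is connected for each $i$. Let $\mathbf{X}_{D_i}\in\mathsf{NSym}$ denote the chromatic noncommutative symmetric function of $D_i$. Then $$\mathsf{NSym} = \mathbb{k}\langle \mathbf{X}_{D_1}, \mathbf{X}_{D_2},\ldots\rangle,$$ that is, $\mathsf{NSym}$ is generated as a $\mathbb{k}$-algebra by the elements $\mathbf{X}_{D_i}$, $i \geq 1$, and the elements of $\{\mathbf{X}_{D_i}\}_{i\ge1}$ are algebraically independent over $\mathbb{k}$ (in the noncommutative sense: no nonzero polynomial over $\mathbb{k}$ in noncommuting variables vanishes on them).
   Context: Fix a field $\mathbb{k}$ of characteristic $0$. **NSym.** $\mathsf{NSym} = \mathbb{k}\langle H_1,H_2,\ldots\rangle$ is the free associative unital $\mathbb{k}$-algebra on noncommuting generators $H_n$ with $\deg H_n = n$. A composition is a finite tuple $\alpha = (\alpha_1,\ldots,\alpha_{\ell(\alpha)})$ of positive integers; $H_\alpha = H_{\alpha_1}\cdots H_{\alpha_{\ell(\alpha)}}$, $H_{()}=1$. For compositions $\alpha,\beta$ of the same integer, write $\beta \ge \alpha$ if $D(\beta) \subseteq D(\alpha)$, where $D(c) = \{c_1, c_1+c_2, \ldots, c_1+\cdots+c_{\ell(c)-1}\}$. The ribbon elements are $R_\alpha = \sum_{\beta\ge\alpha} (-1)^{\ell(\alpha)-\ell(\beta)} H_\beta$. Define $\Psi_n = \sum_{i=0}^{n-1}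 (-1)^i R_{(1^i,\,n-i)}$ for $n \ge 1$, where $(1^i, n-i)$ is the composition consisting of $i$ ones followed by $n-i$, and $\Psi_\alpha = \Psi_{\alpha_1}\Psi_{\alpha_2}\cdots\Psi_{\alpha_{\ell(\alpha)}}$, $\Psi_{()}=1$. **Digraphs.** A digraph $D=(V(D),E(D))$ consists of a finite set $V(D)$ and a set $E(D)$ of ordered pairs (arcs) of elements of $V(D)$, with no loops. Its underlying undirected graph $G$ has vertex set $V(D)$ and edge set $\{\{u,v\} : (u,v)\in E(D)\}$. For a vertex $w$, the outdegree $\mathrm{od}\,w$ is the number of $v$ with $(w,v)\in E(D)$, and the indegree $\mathrm{id}\,w$ is the number of $v$ with $(v,w)\in E(D)$. For $W\subseteq V(D)$, the total degree (computed in all of $D$) is $\mathrm{td}\,W = \sum_{w\in W}\mathrm{od}\,w - \sum_{w\in W}\mathrm{id}\,w$. **The composition $\alpha(S)$.** Let $S\subseteq E(D)$ and $S' = \{\{u,v\} : (u,v)\in S\}\subseteq E(G)$. Consider the vertex sets of the connected components of the spanning subgraph $(V(D),S')$ of $G$. Fix a labeling (total order) $v_1<v_2<\cdots<v_{|V|}$ of $V = V(D)$. For two distinct components $C,C'$ put $C\rhd C'$ if: (1) $\mathrm{td}\,C>\mathrm{td}\,C'$; or (2) $\mathrm{td}\,C=\mathrm{td}\,C'$ and $|C|>|C'|$; or (3) $\mathrm{td}\,C=\mathrm{td}\,C'$, $|C|=|C'|$, and $C$ is lexicographically strictly greater than $C'$, where a vertex subset is identified with the word of its vertex indices written in increasing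 order. Then $\alpha(S)$ is the composition of $|V|$ listing the sizes of the components in the order given by $\rhd$, with $\rhd$-greatest component first (so components of larger total degree come first). The composition $\alpha(S)$ does not depend on the chosen labeling. **Chromatic noncommutative symmetric function.** $$\mathbf{X}_D = \sum_{S\subseteq E(D)} (-1)^{|S|}\,\Psi_{\alpha(S)} \in \mathsf{NSym}.$$ -}

module Defs where

open import Algebra.Bundles using (CommutativeRing; Ring)
import Algebra.Definitions
import Algebra.Properties.Semiring.Exp
import Algebra.Properties.Semiring.Mult
open import Data.Fin.Base using (Fin)
import Data.Fin.Properties as Fin
open import Data.Integer.Base as ℤ using (ℤ; +_)
import Data.Integer.Properties as ℤ
open import Data.List.Base
  using (List; []; _∷_; _++_; map; foldr; filter; length; concatMap;
         allFin; upTo; replicate; cartesianProduct; deduplicate)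
open import Data.List.Membership.Propositional using (_∈_)
open import Data.List.Properties using (≡-dec)
import Data.List.Relation.Binary.Lex.NonStrict as ListLex
open import Data.List.Relation.Binary.Subset.DecPropositional using (_⊆?_)
open import Data.List.Relation.Unary.Any using (here; there)
import Data.List.Sort
open import Data.Nat.Base as ℕ using (ℕ; zero; suc; _∸_)
open import Data.Nat.ListAction using (sum)
import Data.Nat.Properties as ℕ
open import Data.Product.Base using (_×_; _,_)
import Data.Product.Relation.Binary.Lex.NonStrict as ProductLex
open import Data.Sum.Base using (_⊎_; inj₁; inj₂)
open import Level using (Level; 0ℓ; _⊔_) renaming (suc to lsuc)
open import Relation.Binary.Bundles using (DecTotalOrder)
open import Relation.Binary.Construct.Closure.Equivalence using (EqClosure)
open import Relation.Binary.Construct.Closure.ReflexiveTransitive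
  using (ε; _◅_; _◅◅_; gmap)
open import Relation.Binary.Construct.Closure.Symmetric as Sym using (fwd; bwd)
import Relation.Binary.Construct.Flip.EqAndOrd as Flip
import Relation.Binary.Construct.On as On
open import Relation.Binary.Core using (Rel)
open import Relation.Binary.Definitions using (Decidable)
open import Relation.Binary.PropositionalEquality.Core using (_≡_; refl)
open import Relation.Nullary.Decidable
  using (yes; no; map′; _×-dec_; _⊎-dec_)
open import Relation.Nullary.Negation using (¬_)

private
  variable
    c ℓ : Level
    A I J : Set
    n : ℕ

------------------------------------------------------------------------
-- Fields

record Field c ℓ : Set (lsuc (c ⊔ ℓ)) where
  field
    commutativeRing : CommutativeRing c ℓ

  open CommutativeRing commutativeRing public

  field
    1≉0     : ¬ (1# ≈ 0#)
    inverse : ∀ x → ¬ (x ≈ 0#) → Algebra.Definitions.Invertible _≈_ 1# _*_ x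

CharacteristicZero : Field c ℓ → Set ℓ
CharacteristicZero K = ∀ n → ¬ (suc n · 1# ≈ 0#)
  where
  open Field K
  open Algebra.Properties.Semiring.Mult semiring renaming (_×_ to _·_)

------------------------------------------------------------------------
-- The free associative unital algebra 𝕜⟨ I ⟩ on a set I of noncommuting
-- variables: algebra expressions, up to the least congruence containing
-- the laws of associative unital algebras. It serves both as NSym and as
-- the algebra of noncommutative polynomials.

module FreeAlgebra (K : Field c ℓ) where

  private module K = Field K

  infix  8 -_
  infixl 7 _*_
  infixl 6 _+_
  infix  4 _≈_

  data 𝕜⟨_⟩ (I : Set) : Set c where
    con : K.Carrier → 𝕜⟨ I ⟩
    var : I → 𝕜⟨ I ⟩
    _+_ : 𝕜⟨ I ⟩ → 𝕜⟨ I ⟩ → 𝕜⟨ I ⟩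
    _*_ : 𝕜⟨ I ⟩ → 𝕜⟨ I ⟩ → 𝕜⟨ I ⟩
    -_  : 𝕜⟨ I ⟩ → 𝕜⟨ I ⟩

  0# 1# : 𝕜⟨ I ⟩
  0# = con K.0#
  1# = con K.1#

  data _≈_ {I : Set} : Rel 𝕜⟨ I ⟩ (c ⊔ ℓ) where
    ≈-refl      : ∀ {p} → p ≈ p
    ≈-sym       : ∀ {p q} → p ≈ q → q ≈ p
    ≈-trans     : ∀ {p q r} → p ≈ q → q ≈ r → p ≈ r
    +-cong      : ∀ {p p′ q q′} → p ≈ p′ → q ≈ q′ → p + q ≈ p′ + q′
    *-cong      : ∀ {p p′ q q′} → p ≈ p′ → q ≈ q′ → p * q ≈ p′ * q′
    -‿cong      : ∀ {p p′} → p ≈ p′ → - p ≈ - p′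
    +-assoc     : ∀ p q r → (p + q) + r ≈ p + (q + r)
    +-comm      : ∀ p q → p + q ≈ q + p
    +-identityˡ : ∀ p → 0# + p ≈ p
    -‿inverseˡ  : ∀ p → - p + p ≈ 0#
    *-assoc     : ∀ p q r → (p * q) * r ≈ p * (q * r)
    *-identityˡ : ∀ p → 1# * p ≈ p
    distribˡ    : ∀ p q r → p * (q + r) ≈ p * q + p * r
    distribʳ    : ∀ p q r → (q + r) * p ≈ q * p + r * p
    con-cong    : ∀ {a b} → a K.≈ b → con a ≈ con b
    con-+       : ∀ a b → con (a K.+ b) ≈ con a + con b
    con-*       : ∀ a b → con (a K.* b) ≈ con a * con b
    con-central : ∀ a p → con a * p ≈ p * con a

  ring : Set → Ring c (c ⊔ ℓ)
  ring I = record
    { Carrier = 𝕜⟨ I ⟩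
    ; _≈_ = _≈_
    ; _+_ = _+_
    ; _*_ = _*_
    ; -_ = -_
    ; 0# = 0#
    ; 1# = 1#
    ; isRing = record
      { +-isAbelianGroup = record
        { isGroup = record
          { isMonoid = record
            { isSemigroup = record
              { isMagma = record
                { isEquivalence = record
                  { refl = ≈-refl ; sym = ≈-sym ; trans = ≈-trans }
                ; ∙-cong = +-cong
                }
              ; assoc = +-assoc
              }
            ; identity = +-identityˡ ,
                         λ p → ≈-trans (+-comm p 0#) (+-identityˡ p)
            }
          ; inverse = -‿inverseˡ ,
                      λ p → ≈-trans (+-comm p (- p)) (-‿inverseˡ p)
          ; ⁻¹-cong = -‿cong
          }
        ; comm = +-comm
        }
      ; *-cong = *-cong
      ; *-assoc = *-assoc
      ; *-identity = *-identityˡ ,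
                     λ p → ≈-trans (≈-sym (con-central K.1# p)) (*-identityˡ p)
      ; distrib = distribˡ , distribʳ
      }
    }

  _[_] : 𝕜⟨ I ⟩ → (I → 𝕜⟨ J ⟩) → 𝕜⟨ J ⟩
  con a   [ x ] = con a
  var i   [ x ] = x i
  (p + q) [ x ] = p [ x ] + q [ x ]
  (p * q) [ x ] = p [ x ] * q [ x ]
  (- p)   [ x ] = - (p [ x ])

  ∑ : List A → (A → 𝕜⟨ I ⟩) → 𝕜⟨ I ⟩
  ∑ xs f = foldr _+_ 0# (map f xs)

  ∏ : List A → (A → 𝕜⟨ I ⟩) → 𝕜⟨ I ⟩
  ∏ xs f = foldr _*_ 1# (map f xs)

  [-1]^_·_ : ℕ → 𝕜⟨ I ⟩ → 𝕜⟨ I ⟩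
  [-1]^ k · p = con ((K.- K.1#) ^ k) * p
    where open Algebra.Properties.Semiring.Exp K.semiring using (_^_)

  data Subalgebra (x : I → 𝕜⟨ J ⟩) : 𝕜⟨ J ⟩ → Set (c ⊔ ℓ) where
    ∈-generator : ∀ i → Subalgebra x (x i)
    ∈-con       : ∀ a → Subalgebra x (con a)
    ∈-+         : ∀ {p q} → Subalgebra x p → Subalgebra x q → Subalgebra x (p + q)
    ∈-*         : ∀ {p q} → Subalgebra x p → Subalgebra x q → Subalgebra x (p * q)
    ∈-resp      : ∀ {p q} → p ≈ q → Subalgebra x p → Subalgebra x q

  Generates : (I → 𝕜⟨ J ⟩) → Set (c ⊔ ℓ)
  Generates x = ∀ p → Subalgebra x p

  AlgebraicallyIndependent : (I → 𝕜⟨ J ⟩) → Set (c ⊔ ℓ)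
  AlgebraicallyIndependent {I} x = ∀ (P : 𝕜⟨ I ⟩) → P [ x ] ≈ 0# → P ≈ 0#

------------------------------------------------------------------------
-- Compositions
--
-- A composition is a list of positive numbers. Positivity is not part of
-- the type, but only lists of positive numbers are formed below.

Composition : Set
Composition = List ℕ

-- All compositions of n, each exactly once: those of 1 + n arise from
-- those of n by prepending a part 1 or by incrementing the first part.

compositions : ℕ → List Composition
compositions zero    = [] ∷ []
compositions (suc n) = concatMap step (compositions n)
  where
  step : Composition → List Composition
  step []      = (1 ∷ []) ∷ []
  step (a ∷ α) = (1 ∷ a ∷ α) ∷ (suc a ∷ α) ∷ []

partialSums : Composition → List ℕ
partialSums []          = []
partialSums (a ∷ [])    = []
partialSums (a ∷ b ∷ α) = a ∷ map (a ℕ.+_) (partialSums (b ∷ α))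

coarsenings : Composition → List Composition
coarsenings α =
  filter (λ β → _⊆?_ ℕ._≟_ (partialSums β) (partialSums α))
         (compositions (sum α))

------------------------------------------------------------------------
-- NSym

module NSymmetric (K : Field c ℓ) where

  open FreeAlgebra K

  -- The variable with index n is the generator H₁₊ₙ.

  NSym : Set c
  NSym = 𝕜⟨ ℕ ⟩

  H : ℕ → NSym
  H zero    = 1#
  H (suc n) = var n

  R : Composition → NSym
  R α = ∑ (coarsenings α) λ β → [-1]^ (length α ∸ length β) · ∏ β H

  Ψ : ℕ → NSym
  Ψ n = ∑ (upTo n) λ i → [-1]^ i · R (replicate i 1 ++ (n ∸ i) ∷ [])

------------------------------------------------------------------------
-- Digraphs, with vertex set Fin n labelled by its usual order

record Digraph (n : ℕ) : Set₁ where
  field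
    _⟶_      : Rel (Fin n) 0ℓ
    _⟶?_     : Decidable _⟶_
    loopless : ∀ v → ¬ (v ⟶ v)

-- A path in the underlying undirected graph is an element of EqClosure,
-- the reflexive transitive closure of the symmetric closure.

Connected : Digraph n → Set
Connected D = ∀ u v → EqClosure (Digraph._⟶_ D) u v

Arc : ℕ → Set
Arc n = Fin n × Fin n

Joined : List (Arc n) → Rel (Fin n) 0ℓ
Joined S = EqClosure (λ u v → (u , v) ∈ S)

joined? : (S : List (Arc n)) → Decidable (Joined S)
joined? []            u v = map′ (λ { refl → ε }) from (u Fin.≟ v)
  where
  from : Joined [] u v → u ≡ v
  from ε            = refl
  from (fwd () ◅ _)
  from (bwd () ◅ _)
joined? {n} ((a , b) ∷ S) u v = map′ to from
  (joined? S u v ⊎-dec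
   ((joined? S u a ×-dec joined? S b v) ⊎-dec
    (joined? S u b ×-dec joined? S a v)))
  where
  Via : Rel (Fin n) 0ℓ
  Via x y = Joined S x y ⊎
            ((Joined S x a × Joined S b y) ⊎ (Joined S x b × Joined S a y))

  weaken : ∀ {x y} → Joined S x y → Joined ((a , b) ∷ S) x y
  weaken = gmap (λ x → x) (Sym.map there)

  to : ∀ {x y} → Via x y → Joined ((a , b) ∷ S) x y
  to (inj₁ p)              = weaken p
  to (inj₂ (inj₁ (p , q))) = weaken p ◅◅ fwd (here refl) ◅ weaken q
  to (inj₂ (inj₂ (p , q))) = weaken p ◅◅ bwd (here refl) ◅ weaken q

  via-a : ∀ {y} → Via b y → Via a y
  via-a (inj₁ p)              = inj₂ (inj₁ (ε , p))
  via-a (inj₂ (inj₁ (_ , q))) = inj₂ (inj₁ (ε , q))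
  via-a (inj₂ (inj₂ (_ , q))) = inj₁ q

  via-b : ∀ {y} → Via a y → Via b y
  via-b (inj₁ p)              = inj₂ (inj₂ (ε , p))
  via-b (inj₂ (inj₁ (_ , q))) = inj₁ q
  via-b (inj₂ (inj₂ (_ , q))) = inj₂ (inj₂ (ε , q))

  extend : ∀ {x y z} → Joined S x y → Via y z → Via x z
  extend p (inj₁ q)              = inj₁ (p ◅◅ q)
  extend p (inj₂ (inj₁ (q , r))) = inj₂ (inj₁ (p ◅◅ q , r))
  extend p (inj₂ (inj₂ (q , r))) = inj₂ (inj₂ (p ◅◅ q , r))

  from : ∀ {x y} → Joined ((a , b) ∷ S) x y → Via x y
  from ε                       = inj₁ ε
  from (fwd (here refl) ◅ p)   = via-a (from p)
  from (bwd (here refl) ◅ p)   = via-b (from p)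
  from (fwd (there xy∈S) ◅ p)  = extend (fwd xy∈S ◅ ε) (from p)
  from (bwd (there yx∈S) ◅ p)  = extend (bwd yx∈S ◅ ε) (from p)

-- A set of vertices is represented by its increasing word.

VertexSet : ℕ → Set
VertexSet n = List (Fin n)

components : List (Arc n) → List (VertexSet n)
components {n} S =
  deduplicate (≡-dec Fin._≟_) (map (λ v → filter (joined? S v) (allFin n)) (allFin n))

sublists : List A → List (List A)
sublists []       = [] ∷ []
sublists (x ∷ xs) = sublists xs ++ map (x ∷_) (sublists xs)

module _ (D : Digraph n) where

  open Digraph D

  arcs : List (Arc n)
  arcs = filter (λ (u , v) → u ⟶? v) (cartesianProduct (allFin n) (allFin n))

  od id : Fin n → ℕ
  od w = length (filter (λ v → w ⟶? v) (allFin n))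
  id w = length (filter (λ v → v ⟶? w) (allFin n))

  td : VertexSet n → ℤ
  td W = + sum (map od W) ℤ.- + sum (map id W)

  -- The order with C ≤ C′ iff C = C′ or C ⊳ C′, so that sorting puts the
  -- ⊳-greatest set first: (td C , |C| , C) is compared lexicographically,
  -- and the resulting order reversed.

  ⊵-decTotalOrder : DecTotalOrder 0ℓ 0ℓ 0ℓ
  ⊵-decTotalOrder = Flip.decTotalOrder (On.decTotalOrder keys key)
    where
    keys : DecTotalOrder 0ℓ 0ℓ 0ℓ
    keys = ProductLex.×-decTotalOrder ℤ.≤-decTotalOrder
             (ProductLex.×-decTotalOrder ℕ.≤-decTotalOrder
               (ListLex.≤-decTotalOrder (Fin.≤-decTotalOrder n)))

    key : VertexSet n → ℤ × ℕ × VertexSet n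
    key C = td C , length C , C

  α : List (Arc n) → Composition
  α S = map length (sort (components S))
    where open Data.List.Sort ⊵-decTotalOrder using (sort)

------------------------------------------------------------------------
-- The chromatic noncommutative symmetric function

module _ (K : Field c ℓ) where

  open FreeAlgebra K
  open NSymmetric K

  𝐗 : Digraph n → NSym
  𝐗 D = ∑ (sublists (arcs D)) λ S → [-1]^ (length S) · ∏ (α D S) Ψ

{-# OPTIONS --safe #-}
module Submission where

-- Only the S that connect all of V(Dₙ) have α(S) = (n), and Ψₙ = n Hₙ +
-- (a polynomial in H₁, …, Hₙ₋₁), so X_{Dₙ} = n cₙ Hₙ + (a polynomial in
-- H₁, …, Hₙ₋₁) where cₙ = Σ (-1)^|S| over the connected spanning S.
-- Deletion–contraction shows (-1)ⁿ⁻¹ cₙ to be a positive integer. Hence the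
-- substitution Hₙ ↦ X_{Dₙ} is triangular with invertible diagonal, and so
-- it can be inverted recursively.

open import Defs
open import Algebra.Bundles using (Ring)
open import Algebra.Definitions using (RightInvertible)
open import Algebra.Properties.CommutativeSemigroup using (interchange)
import Algebra.Properties.Ring
import Algebra.Properties.Semiring.Exp
import Algebra.Properties.Semiring.Mult
open import Data.Bool.Base using (Bool; true; false; if_then_else_)
open import Data.Empty using (⊥-elim)
open import Data.Fin.Base using (Fin; zero; suc; punchIn; punchOut)
import Data.Fin.Properties as Fin
open import Data.List.Base
  using (List; []; _∷_; _++_; map; foldr; filter; length; concatMap;
         allFin; tabulate; upTo; replicate; deduplicate)
open import Data.List.Membership.Propositional using (_∈_; lose)
open import Data.List.Membership.Propositional.Properties
  using (∈-map⁺; ∈-map⁻; ∈-filter⁺; ∈-filter⁻; ∈-cartesianProduct⁺; ∈-allFin; ∈-upTo⁻)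
open import Data.List.Properties
  using (≡-dec; length-map; length-++; length-replicate; length-upTo; length-tabulate;
         concatMap-++; ++-assoc; filter-++; filter-accept; filter-all; filter-none;
         filter-notAll)
open import Data.List.Relation.Binary.Permutation.Propositional using (↭-sym)
open import Data.List.Relation.Binary.Permutation.Propositional.Properties
  using (All-resp-↭; ↭-singleton-inv)
open import Data.List.Relation.Binary.Subset.DecPropositional using (_⊆?_)
open import Data.List.Relation.Unary.All as All using (All; []; _∷_)
import Data.List.Relation.Unary.All.Properties as All
open import Data.List.Relation.Unary.Any using (here; there)
import Data.List.Sort
open import Data.Nat.Base as ℕ using (ℕ; zero; suc; _≤_; _<_; _∸_; z≤n; s≤s)
open import Data.Nat.Induction using (<-rec)
open import Data.Nat.ListAction using (sum)
import Data.Nat.Properties as ℕ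
open import Data.Product.Base using (∃; _×_; _,_; proj₁; proj₂)
import Data.Product.Base as Product
open import Data.Sum.Base using (_⊎_; inj₁; inj₂)
open import Function.Base using (_∘_)
open import Function.Bundles using (_⇔_; mk⇔; module Equivalence)
open import Level using (Level; _⊔_)
open import Relation.Binary.Construct.Closure.Equivalence
  using (isEquivalence; symmetric; gfold; return)
open import Relation.Binary.Construct.Closure.ReflexiveTransitive using (ε; _◅_; _◅◅_)
open import Relation.Binary.Construct.Closure.Symmetric using (fwd; bwd)
open import Relation.Binary.PropositionalEquality
  using (_≡_; _≢_; _≗_; refl; sym; trans; cong; cong₂; subst; subst₂)
import Relation.Binary.Reasoning.Setoid
open import Relation.Nullary.Decidable
  using (Dec; yes; no; does; dec-true; dec-false; does-⇔)
open import Relation.Nullary.Negation using (¬_; contradiction)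

private
  variable
    c ℓ : Level
    A I J : Set
    m n : ℕ

-- Spanning sets of arcs and contraction

Spanning : List (Arc n) → Set
Spanning S = ∀ u v → Joined S u v

spanning? : (S : List (Arc n)) → Dec (Spanning S)
spanning? S = Fin.all? λ u → Fin.all? λ v → joined? S u v

spanningᵇ : List (Arc n) → Bool
spanningᵇ S = does (spanning? S)

Loopless : List (Arc n) → Set
Loopless S = ∀ {a b} → (a , b) ∈ S → a ≢ b

-- The quotient map of the contraction: `u` is the vertex deleted, its image is that of `v`, and
-- `punchIn u` is a section.
merge : {u v : Fin (suc n)} → u ≢ v → Fin (suc n) → Fin n
merge {u = u} u≢v x with u Fin.≟ x
... | yes _  = punchOut u≢v
... | no u≢x = punchOut u≢x

mergeArc : {u v : Fin (suc n)} → u ≢ v → Arc (suc n) → Arc n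
mergeArc u≢v = Product.map (merge u≢v) (merge u≢v)

module _ {u v : Fin (suc n)} (u≢v : u ≢ v) where

  merge-u≡merge-v : merge u≢v u ≡ merge u≢v v
  merge-u≡merge-v with u Fin.≟ u | u Fin.≟ v
  ... | no u≢u | _       = contradiction refl u≢u
  ... | yes _  | yes u≡v = contradiction u≡v u≢v
  ... | yes _  | no _    = Fin.punchOut-cong u refl

  merge-punchIn : ∀ y → merge u≢v (punchIn u y) ≡ y
  merge-punchIn y with u Fin.≟ punchIn u y
  ... | yes u≡ = contradiction (sym u≡) (Fin.punchInᵢ≢i u y)
  ... | no _   = trans (Fin.punchOut-cong u refl) (Fin.punchOut-punchIn u)

  merge-fibre : ∀ {x y} → merge u≢v x ≡ merge u≢v y → x ≢ y →
                (x ≡ u × y ≡ v) ⊎ (x ≡ v × y ≡ u)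
  merge-fibre {x} {y} eq x≢y with u Fin.≟ x | u Fin.≟ y
  ... | yes refl | yes refl = contradiction refl x≢y
  ... | yes refl | no u≢y   = inj₁ (refl , sym (Fin.punchOut-injective u≢v u≢y eq))
  ... | no u≢x   | yes refl = inj₂ (Fin.punchOut-injective u≢x u≢v eq , refl)
  ... | no u≢x   | no u≢y   = contradiction (Fin.punchOut-injective u≢x u≢y eq) x≢y

  contract : List (Arc (suc n)) → List (Arc n)
  contract = map (mergeArc u≢v)

  joined-merge : ∀ {S x y} → Joined ((u , v) ∷ S) x y →
                 Joined (contract S) (merge u≢v x) (merge u≢v y)
  joined-merge {S} = gfold (isEquivalence _) (merge u≢v) arc
    where
    arc : ∀ {a b} → (a , b) ∈ (u , v) ∷ S →
          Joined (contract S) (merge u≢v a) (merge u≢v b)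
    arc (here refl)  = subst (Joined _ _) merge-u≡merge-v ε
    arc (there ab∈S) = return (∈-map⁺ (mergeArc u≢v) ab∈S)

  -- Going down and back up moves no vertex except `u`, which lands on `v`, and the arc in front of
  -- `S` joins these two.
  punchIn-merge : ∀ {S} x → Joined ((u , v) ∷ S) (punchIn u (merge u≢v x)) x
  punchIn-merge x with u Fin.≟ x
  ... | yes refl = subst (λ w → Joined _ w u) (sym (Fin.punchIn-punchOut u≢v))
                         (bwd (here refl) ◅ ε)
  ... | no u≢x   = subst (λ w → Joined _ w x) (sym (Fin.punchIn-punchOut u≢x)) ε

  joined-punchIn : ∀ {S x y} → Joined (contract S) x y →
                   Joined ((u , v) ∷ S) (punchIn u x) (punchIn u y)
  joined-punchIn {S} = gfold (isEquivalence _) (punchIn u) arc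
    where
    arc : ∀ {a b} → (a , b) ∈ contract S →
          Joined ((u , v) ∷ S) (punchIn u a) (punchIn u b)
    arc ab∈ with (x , y) , xy∈S , refl ← ∈-map⁻ (mergeArc u≢v) ab∈ =
      punchIn-merge x ◅◅ return (there xy∈S) ◅◅ symmetric _ (punchIn-merge y)

  -- Paths descend along `merge` and lift along `punchIn u`; `punchIn-merge` connects each endpoint
  -- with its lift.
  spanning-contract : ∀ {S} → Spanning ((u , v) ∷ S) ⇔ Spanning (contract S)
  spanning-contract = mk⇔
    (λ spans x y → subst₂ (Joined _) (merge-punchIn x) (merge-punchIn y)
                     (joined-merge (spans (punchIn u x) (punchIn u y))))
    (λ spans x y → symmetric _ (punchIn-merge x)
                     ◅◅ joined-punchIn (spans (merge u≢v x) (merge u≢v y))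
                     ◅◅ punchIn-merge y)

-- Each use of the arc (u , v) is rerouted along the given path in `S`. With the empty path this
-- removes a loop.
spanning-without : ∀ {u v : Fin n} {S} → Joined S u v → Spanning ((u , v) ∷ S) → Spanning S
spanning-without {u = u} {v} {S} u~v spans x y = gfold (isEquivalence _) (λ z → z) arc (spans x y)
  where
  arc : ∀ {a b} → (a , b) ∈ (u , v) ∷ S → Joined S a b
  arc (here refl)  = u~v
  arc (there ab∈S) = return ab∈S

spanning-cons : ∀ {e : Arc n} {S} → Spanning S → Spanning (e ∷ S)
spanning-cons spans x y = gfold (isEquivalence _) (λ z → z) (return ∘ there) (spans x y)

-- If contracting (u , v) creates a loop then u and v are still joined
-- after deleting it.
contract-loopless : ∀ {u v : Fin (suc n)} (u≢v : u ≢ v) {S} → Loopless S →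
                    ¬ Joined S u v → Loopless (contract u≢v S)
contract-loopless u≢v loopless u≁v ab∈ eq
  with (x , y) , xy∈S , refl ← ∈-map⁻ (mergeArc u≢v) ab∈
  with merge-fibre u≢v eq (loopless xy∈S)
... | inj₁ (refl , refl) = u≁v (return xy∈S)
... | inj₂ (refl , refl) = u≁v (bwd xy∈S ◅ ε)

-- The alternating sum over spanning sets

module _ (K : Field c ℓ) where

  open Field K hiding (zero; refl; sym; trans)
  open Field K using () renaming (refl to ≈-refl; sym to ≈-sym; trans to ≈-trans)
  open Algebra.Properties.Ring ring
  open Algebra.Properties.Semiring.Exp semiring
  open Algebra.Properties.Semiring.Mult semiring using (×-homo-+) renaming (_×_ to _·_)
  open import Relation.Binary.Reasoning.Setoid setoid

  ∑ᴷ : List A → (A → Carrier) → Carrier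
  ∑ᴷ xs a = foldr _+_ 0# (map a xs)

  ∑ᴷ-++ : ∀ (xs ys : List A) a → ∑ᴷ (xs ++ ys) a ≈ ∑ᴷ xs a + ∑ᴷ ys a
  ∑ᴷ-++ []       ys a = ≈-sym (+-identityˡ _)
  ∑ᴷ-++ (x ∷ xs) ys a = ≈-trans (+-congˡ (∑ᴷ-++ xs ys a)) (≈-sym (+-assoc _ _ _))

  ∑ᴷ-cong : ∀ (xs : List A) {a b} → a ≗ b → ∑ᴷ xs a ≡ ∑ᴷ xs b
  ∑ᴷ-cong []       a≗b = refl
  ∑ᴷ-cong (x ∷ xs) a≗b = cong₂ _+_ (a≗b x) (∑ᴷ-cong xs a≗b)

  signed : (List A → Bool) → List A → Carrier
  signed χ S = if χ S then (- 1#) ^ length S else 0#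

  signed-∷ : ∀ χ (x : A) S → signed χ (x ∷ S) ≈ - signed (χ ∘ (x ∷_)) S
  signed-∷ χ x S with χ (x ∷ S)
  ... | true  = -1*x≈-x _
  ... | false = ≈-sym -0#≈0#

  -- `χ` is arbitrary, not just `spanningᵇ`, since recursion on the arc list turns it into
  -- `χ ∘ (x ∷_)` once `x` has been chosen.
  alternatingSum : (List A → Bool) → List A → Carrier
  alternatingSum χ E = ∑ᴷ (sublists E) (signed χ)

  alternatingSum-cong : ∀ {χ χ′} → χ ≗ χ′ → (E : List A) →
                        alternatingSum χ E ≡ alternatingSum χ′ E
  alternatingSum-cong χ≗χ′ E = ∑ᴷ-cong (sublists E) λ S →
    cong (if_then (- 1#) ^ length S else 0#) (χ≗χ′ S)

  -- The sublists split into those without and those with `x`, the latter carrying one more sign.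
  -- For `spanningᵇ` and an arc that is not a loop, these become the deletion and the contraction
  -- term.
  alternatingSum-∷ : ∀ χ (x : A) E →
    alternatingSum χ (x ∷ E) ≈ alternatingSum χ E - alternatingSum (χ ∘ (x ∷_)) E
  alternatingSum-∷ χ x E =
    ≈-trans (∑ᴷ-++ (sublists E) _ _) (+-congˡ (negated (sublists E)))
    where
    negated : ∀ Ss → ∑ᴷ (map (x ∷_) Ss) (signed χ) ≈ - ∑ᴷ Ss (signed (χ ∘ (x ∷_)))
    negated []       = ≈-sym -0#≈0#
    negated (S ∷ Ss) = ≈-trans (+-cong (signed-∷ χ x S) (negated Ss)) (-‿+-comm _ _)

  -- Sublists are chosen by position, so parallel arcs produced by a contraction still count as
  -- distinct arcs.
  alternatingSum-map : ∀ {B : Set} (f : A → B) χ E →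
    alternatingSum χ (map f E) ≈ alternatingSum (χ ∘ map f) E
  alternatingSum-map f χ []      = ≈-refl
  alternatingSum-map f χ (x ∷ E) = begin
    alternatingSum χ (f x ∷ map f E)
      ≈⟨ alternatingSum-∷ χ (f x) (map f E) ⟩
    alternatingSum χ (map f E) - alternatingSum (χ ∘ (f x ∷_)) (map f E)
      ≈⟨ +-cong (alternatingSum-map f χ E) (-‿cong (alternatingSum-map f (χ ∘ (f x ∷_)) E)) ⟩
    alternatingSum (χ ∘ map f) E - alternatingSum (χ ∘ (f x ∷_) ∘ map f) E
      ≈⟨ alternatingSum-∷ (χ ∘ map f) x E ⟨
    alternatingSum (χ ∘ map f) (x ∷ E)
      ∎

  -- The alternating sum is the linear coefficient of the chromatic polynomial of the multigraph `E`
  -- on n + 1 vertices. `N` is a natural number because positivity has no meaning in `K`. Positivity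
  -- is a conditional clause since the recursion also meets disconnected lists and lists with loops.
  SignedCount : (n : ℕ) → List (Arc (suc n)) → Set ℓ
  SignedCount n E = ∃ λ N → alternatingSum spanningᵇ E ≈ (- 1#) ^ n * (N · 1#) ×
                            (Spanning E → Loopless E → 0 < N)

  signedCount-[] : ∀ n → SignedCount n []
  signedCount-[] zero    = 1 , ≈-trans ≡1 (≈-sym (*-identityˡ _)) , λ _ _ → s≤s z≤n
    where
    ≡1 : alternatingSum (spanningᵇ {1}) [] ≈ 1 · 1#
    ≡1 rewrite dec-true (spanning? {1} []) (λ { zero zero → ε }) = ≈-refl
  signedCount-[] (suc n) = 0 , ≈-trans ≡0 (≈-sym (zeroʳ _)) ,
                           λ spans _ → ⊥-elim (not-spanning spans)
    where
    not-spanning : ¬ Spanning {suc (suc n)} []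
    not-spanning spans with spans zero (suc zero)
    ... | fwd () ◅ _
    ... | bwd () ◅ _

    ≡0 : alternatingSum (spanningᵇ {suc (suc n)}) [] ≈ 0#
    ≡0 rewrite dec-false (spanning? {suc (suc n)} []) not-spanning = +-identityʳ 0#

  -- Adding the loop does not change whether a set is spanning, so the two halves of the sum cancel.
  signedCount-loop : ∀ (u : Fin (suc n)) E → SignedCount n ((u , u) ∷ E)
  signedCount-loop u E = 0 , ≈-trans ≡0 (≈-sym (zeroʳ _)) ,
                         λ _ loopless → contradiction refl (loopless (here refl))
    where
    ≡0 : alternatingSum spanningᵇ ((u , u) ∷ E) ≈ 0#
    ≡0 = begin
      alternatingSum spanningᵇ ((u , u) ∷ E)
        ≈⟨ alternatingSum-∷ spanningᵇ (u , u) E ⟩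
      alternatingSum spanningᵇ E - alternatingSum (spanningᵇ ∘ ((u , u) ∷_)) E
        ≡⟨ cong (λ z → alternatingSum spanningᵇ E - z)
             (alternatingSum-cong (λ S → does-⇔ (mk⇔ (spanning-without ε) spanning-cons)
                                                (spanning? _) (spanning? S)) E) ⟩
      alternatingSum spanningᵇ E - alternatingSum spanningᵇ E
        ≈⟨ -‿inverseʳ _ ⟩
      0# ∎

  -- Contraction loses one vertex, so its sign is opposite to that of deletion. This absorbs the
  -- minus sign of the recursion, and the two counts add without cancellation.
  signedCount-∷ : ∀ {u v : Fin (suc (suc n))} (u≢v : u ≢ v) E →
    SignedCount (suc n) E → SignedCount n (contract u≢v E) →
    SignedCount (suc n) ((u , v) ∷ E)
  signedCount-∷ {n} {u} {v} u≢v E (N₁ , eq₁ , pos₁) (N₂ , eq₂ , pos₂) =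
    N₁ ℕ.+ N₂ , eq , pos
    where
    s : Carrier
    s = (- 1#) ^ suc n

    contracted : alternatingSum (spanningᵇ ∘ ((u , v) ∷_)) E ≈ (- 1#) ^ n * (N₂ · 1#)
    contracted = begin
      alternatingSum (spanningᵇ ∘ ((u , v) ∷_)) E
        ≡⟨ alternatingSum-cong (λ S → does-⇔ (spanning-contract u≢v)
                                             (spanning? _) (spanning? _)) E ⟩
      alternatingSum (spanningᵇ ∘ contract u≢v) E
        ≈⟨ alternatingSum-map (mergeArc u≢v) spanningᵇ E ⟨
      alternatingSum spanningᵇ (contract u≢v E)
        ≈⟨ eq₂ ⟩
      (- 1#) ^ n * (N₂ · 1#) ∎

    eq : alternatingSum spanningᵇ ((u , v) ∷ E) ≈ s * ((N₁ ℕ.+ N₂) · 1#)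
    eq = begin
      alternatingSum spanningᵇ ((u , v) ∷ E)
        ≈⟨ alternatingSum-∷ spanningᵇ (u , v) E ⟩
      alternatingSum spanningᵇ E - alternatingSum (spanningᵇ ∘ ((u , v) ∷_)) E
        ≈⟨ +-cong eq₁ (-‿cong contracted) ⟩
      s * (N₁ · 1#) - (- 1#) ^ n * (N₂ · 1#)
        ≈⟨ +-congˡ (-‿distribˡ-* _ _) ⟩
      s * (N₁ · 1#) + - (- 1#) ^ n * (N₂ · 1#)
        ≈⟨ +-congˡ (*-congʳ (-1*x≈-x _)) ⟨
      s * (N₁ · 1#) + s * (N₂ · 1#)
        ≈⟨ distribˡ s _ _ ⟨
      s * (N₁ · 1# + N₂ · 1#)
        ≈⟨ *-congˡ (×-homo-+ 1# N₁ N₂) ⟨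
      s * ((N₁ ℕ.+ N₂) · 1#) ∎

    pos : Spanning ((u , v) ∷ E) → Loopless ((u , v) ∷ E) → 0 < N₁ ℕ.+ N₂
    -- One positive count suffices. If the arc lies on a cycle, deletion leaves a spanning list; if
    -- it is a bridge, contraction creates no loop.
    pos spans loopless with joined? E u v
    ... | yes u~v = ℕ.m≤n⇒m≤n+o N₂ (pos₁ (spanning-without u~v spans) (loopless ∘ there))
    ... | no u≁v  = ℕ.m≤n⇒m≤o+n N₁
      (pos₂ (Equivalence.to (spanning-contract u≢v) spans)
            (contract-loopless u≢v (loopless ∘ there) u≁v))

  signedCount : ∀ E → SignedCount n E
  signedCount E = go (length E) E refl
    where
    -- The recursion is on the length because `contract u≢v E` is not a subterm of the arc list.
    go : ∀ {n} k E → length E ≡ k → SignedCount n E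
    go zero    []            _  = signedCount-[] _
    go (suc k) ((u , v) ∷ E) eq with u Fin.≟ v
    go (suc k) ((u , _) ∷ E) eq | yes refl = signedCount-loop u E
    go {zero}  (suc k) ((zero , zero) ∷ E) eq | no 0≢0 = contradiction refl 0≢0
    go {suc n} (suc k) ((u , v) ∷ E)       eq | no u≢v =
      signedCount-∷ u≢v E (go k E (ℕ.suc-injective eq))
        (go k (contract u≢v E)
            (trans (length-map (mergeArc u≢v) E) (ℕ.suc-injective eq)))

-- Triangular families in the free algebra

module _ (K : Field c ℓ) where

  open FreeAlgebra K
  private
    module K = Field K
    module F {I : Set} = Ring (ring I)
    module ≈-Reasoning {I : Set} = Relation.Binary.Reasoning.Setoid (Ring.setoid (ring I))

  []-congˡ : ∀ {x : I → 𝕜⟨ J ⟩} {p q} → p ≈ q → p [ x ] ≈ q [ x ]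
  []-congˡ ≈-refl             = ≈-refl
  []-congˡ (≈-sym eq)         = ≈-sym ([]-congˡ eq)
  []-congˡ (≈-trans eq eq′)   = ≈-trans ([]-congˡ eq) ([]-congˡ eq′)
  []-congˡ (+-cong eq eq′)    = +-cong ([]-congˡ eq) ([]-congˡ eq′)
  []-congˡ (*-cong eq eq′)    = *-cong ([]-congˡ eq) ([]-congˡ eq′)
  []-congˡ (-‿cong eq)        = -‿cong ([]-congˡ eq)
  []-congˡ (+-assoc p q r)    = +-assoc _ _ _
  []-congˡ (+-comm p q)       = +-comm _ _
  []-congˡ (+-identityˡ p)    = +-identityˡ _
  []-congˡ (-‿inverseˡ p)     = -‿inverseˡ _
  []-congˡ (*-assoc p q r)    = *-assoc _ _ _
  []-congˡ (*-identityˡ p)    = *-identityˡ _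
  []-congˡ (distribˡ p q r)   = distribˡ _ _ _
  []-congˡ (distribʳ p q r)   = distribʳ _ _ _
  []-congˡ (con-cong eq)      = con-cong eq
  []-congˡ (con-+ a b)        = con-+ a b
  []-congˡ (con-* a b)        = con-* a b
  []-congˡ (con-central a p)  = con-central a _

  []-congʳ : ∀ {x y : I → 𝕜⟨ J ⟩} → (∀ i → x i ≈ y i) → ∀ p → p [ x ] ≈ p [ y ]
  []-congʳ x≈y (con a) = ≈-refl
  []-congʳ x≈y (var i) = x≈y i
  []-congʳ x≈y (p + q) = +-cong ([]-congʳ x≈y p) ([]-congʳ x≈y q)
  []-congʳ x≈y (p * q) = *-cong ([]-congʳ x≈y p) ([]-congʳ x≈y q)
  []-congʳ x≈y (- p)   = -‿cong ([]-congʳ x≈y p)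

  []-assoc : ∀ {L : Set} {x : I → 𝕜⟨ J ⟩} {y : J → 𝕜⟨ L ⟩} p →
             p [ x ] [ y ] ≡ p [ (λ i → x i [ y ]) ]
  []-assoc (con a) = refl
  []-assoc (var i) = refl
  []-assoc (p + q) = cong₂ _+_ ([]-assoc p) ([]-assoc q)
  []-assoc (p * q) = cong₂ _*_ ([]-assoc p) ([]-assoc q)
  []-assoc (- p)   = cong -_ ([]-assoc p)

  []-identity : ∀ (p : 𝕜⟨ I ⟩) → p [ var ] ≡ p
  []-identity (con a) = refl
  []-identity (var i) = refl
  []-identity (p + q) = cong₂ _+_ ([]-identity p) ([]-identity q)
  []-identity (p * q) = cong₂ _*_ ([]-identity p) ([]-identity q)
  []-identity (- p)   = cong -_ ([]-identity p)

  -- Substituting `y` is a left inverse of substituting `x`, so it carries a relation among the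
  -- `x i` back to `P` itself.
  invertible⇒independent : ∀ {x : I → 𝕜⟨ J ⟩} (y : J → 𝕜⟨ I ⟩) →
                           (∀ i → x i [ y ] ≈ var i) → AlgebraicallyIndependent x
  invertible⇒independent {x = x} y x[y]≈var P P[x]≈0 = begin
    P                            ≡⟨ []-identity P ⟨
    P [ var ]                    ≈⟨ []-congʳ x[y]≈var P ⟨
    P [ (λ i → x i [ y ]) ]      ≡⟨ []-assoc P ⟨
    P [ x ] [ y ]                ≈⟨ []-congˡ P[x]≈0 ⟩
    0#                           ∎
    where open ≈-Reasoning

  module _ {x : I → 𝕜⟨ J ⟩} where

    ∈-neg : ∀ {p} → Subalgebra x p → Subalgebra x (- p)
    ∈-neg {p} p∈ = ∈-resp
      (≈-trans (*-cong con-‿ ≈-refl) (-1*x≈-x p))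
      (∈-* (∈-con (K.- K.1#)) p∈)
      where
      open Algebra.Properties.Ring (ring J)
      con-‿ : con (K.- K.1#) ≈ - 1#
      con-‿ = +-inverseˡ-unique _ _
        (≈-trans (≈-sym (con-+ _ _)) (con-cong (K.-‿inverseˡ K.1#)))

    ∈-∑ : ∀ {A : Set} {xs : List A} {f} → All (Subalgebra x ∘ f) xs → Subalgebra x (∑ xs f)
    ∈-∑ []         = ∈-con K.0#
    ∈-∑ (p∈ ∷ ps∈) = ∈-+ p∈ (∈-∑ ps∈)

    ∈-∏ : ∀ {A : Set} {xs : List A} {f} → All (Subalgebra x ∘ f) xs → Subalgebra x (∏ xs f)
    ∈-∏ []         = ∈-con K.1#
    ∈-∏ (p∈ ∷ ps∈) = ∈-* p∈ (∈-∏ ps∈)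

    ∈-trans : ∀ {L : Set} {y : L → 𝕜⟨ J ⟩} → (∀ i → Subalgebra y (x i)) →
              ∀ {p} → Subalgebra x p → Subalgebra y p
    ∈-trans x∈ (∈-generator i) = x∈ i
    ∈-trans x∈ (∈-con a)       = ∈-con a
    ∈-trans x∈ (∈-+ p∈ q∈)     = ∈-+ (∈-trans x∈ p∈) (∈-trans x∈ q∈)
    ∈-trans x∈ (∈-* p∈ q∈)     = ∈-* (∈-trans x∈ p∈) (∈-trans x∈ q∈)
    ∈-trans x∈ (∈-resp eq p∈)  = ∈-resp eq (∈-trans x∈ p∈)

    vars∈⇒generates : (∀ j → Subalgebra x (var j)) → Generates x
    vars∈⇒generates var∈ (con a) = ∈-con a
    vars∈⇒generates var∈ (var j) = var∈ j
    vars∈⇒generates var∈ (p + q) = ∈-+ (vars∈⇒generates var∈ p) (vars∈⇒generates var∈ q)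
    vars∈⇒generates var∈ (p * q) = ∈-* (vars∈⇒generates var∈ p) (vars∈⇒generates var∈ q)
    vars∈⇒generates var∈ (- p)   = ∈-neg (vars∈⇒generates var∈ p)

    -- The induction is on the derivation of membership: as an expression `p` may mention variables
    -- on which `y` and `z` differ, as long as it equals a polynomial in the `x i`.
    []-cong-∈ : ∀ {L : Set} {y z : J → 𝕜⟨ L ⟩} → (∀ i → x i [ y ] ≈ x i [ z ]) →
                ∀ {p} → Subalgebra x p → p [ y ] ≈ p [ z ]
    []-cong-∈ y≈z (∈-generator i) = y≈z i
    []-cong-∈ y≈z (∈-con a)       = ≈-refl
    []-cong-∈ y≈z (∈-+ p∈ q∈)     = +-cong ([]-cong-∈ y≈z p∈) ([]-cong-∈ y≈z q∈)
    []-cong-∈ y≈z (∈-* p∈ q∈)     = *-cong ([]-cong-∈ y≈z p∈) ([]-cong-∈ y≈z q∈)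
    []-cong-∈ y≈z (∈-resp eq p∈)  =
      ≈-trans (≈-sym ([]-congˡ eq)) (≈-trans ([]-cong-∈ y≈z p∈) ([]-congˡ eq))

  -- As `var k` is the generator H of index k + 1, these are the polynomials in H₁, ..., Hₙ, up to
  -- `≈`.
  Lower : ℕ → 𝕜⟨ ℕ ⟩ → Set (c ⊔ ℓ)
  Lower n = Subalgebra {I = ∃ (_< n)} (var ∘ proj₁)

  lower-mono : m ≤ n → ∀ {p} → Lower m p → Lower n p
  lower-mono m≤n = ∈-trans λ (k , k<m) → ∈-generator (k , ℕ.<-≤-trans k<m m≤n)

  -- `v` is a parameter so that an element can be expanded first in `Ψ (suc n)` and then in `var n`.
  -- The coefficient may be zero, which lets lower terms take part in sums.
  record Leading (n : ℕ) (v : 𝕜⟨ ℕ ⟩) (a : K.Carrier) (p : 𝕜⟨ ℕ ⟩) : Set (c ⊔ ℓ) where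
    constructor mkLeading
    field
      tail   : 𝕜⟨ ℕ ⟩
      tail∈  : Lower n tail
      p≈av+t : p ≈ con a * v + tail

  leading-cong : ∀ {v a b p} → a K.≈ b → Leading n v a p → Leading n v b p
  leading-cong a≈b (mkLeading L L∈ eq) =
    mkLeading L L∈ (≈-trans eq (+-cong (*-cong (con-cong a≈b) ≈-refl) ≈-refl))

  leading-resp : ∀ {v a p q} → p ≈ q → Leading n v a p → Leading n v a q
  leading-resp p≈q (mkLeading L L∈ eq) = mkLeading L L∈ (≈-trans (≈-sym p≈q) eq)

  lower⇒leading : ∀ {v p} → Lower n p → Leading n v K.0# p
  lower⇒leading {v = v} {p} p∈ =
    mkLeading p p∈ (≈-sym (≈-trans (+-cong (F.zeroˡ v) ≈-refl) (+-identityˡ p)))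

  leading⇒lower : ∀ {v a p} → Leading m v a p → Lower n v → m ≤ n → Lower n p
  leading⇒lower (mkLeading L L∈ eq) v∈ m≤n =
    ∈-resp (≈-sym eq) (∈-+ (∈-* (∈-con _) v∈) (lower-mono m≤n L∈))

  leading-self : ∀ {v} → Leading n v K.1# v
  leading-self {v = v} =
    mkLeading 0# (∈-con K.0#) (≈-sym (≈-trans (F.+-identityʳ _) (*-identityˡ v)))

  leading-+ : ∀ {v a b p q} → Leading n v a p → Leading n v b q →
              Leading n v (a K.+ b) (p + q)
  leading-+ {v = v} {a} {b} {p} {q} (mkLeading L L∈ eq) (mkLeading M M∈ eq′) =
    mkLeading (L + M) (∈-+ L∈ M∈) (begin
    p + q                             ≈⟨ +-cong eq eq′ ⟩
    (con a * v + L) + (con b * v + M) ≈⟨ interchange F.+-commutativeSemigroup _ _ _ _ ⟩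
    (con a * v + con b * v) + (L + M) ≈⟨ +-cong (distribʳ v _ _) ≈-refl ⟨
    (con a + con b) * v + (L + M)     ≈⟨ +-cong (*-cong (con-+ a b) ≈-refl) ≈-refl ⟨
    con (a K.+ b) * v + (L + M)       ∎)
    where open ≈-Reasoning

  leading-trans : ∀ {v w a b p} → Leading n v a p → Leading n w b v →
                  Leading n w (a K.* b) p
  leading-trans {v = v} {w} {a} {b} {p} (mkLeading L L∈ eq) (mkLeading M M∈ eq′) =
    mkLeading (con a * M + L) (∈-+ (∈-* (∈-con a) M∈) L∈) (begin
    p                                     ≈⟨ eq ⟩
    con a * v + L                         ≈⟨ +-cong (*-cong ≈-refl eq′) ≈-refl ⟩
    con a * (con b * w + M) + L           ≈⟨ +-cong (distribˡ _ _ _) ≈-refl ⟩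
    con a * (con b * w) + con a * M + L   ≈⟨ +-assoc _ _ _ ⟩
    con a * (con b * w) + (con a * M + L) ≈⟨ +-cong (*-assoc _ _ _) ≈-refl ⟨
    con a * con b * w + (con a * M + L)   ≈⟨ +-cong (*-cong (con-* a b) ≈-refl) ≈-refl ⟨
    con (a K.* b) * w + (con a * M + L)   ∎)
    where open ≈-Reasoning

  leading-scale : ∀ {v b p} a → Leading n v b p → Leading n v (a K.* b) (con a * p)
  leading-scale a = leading-trans (mkLeading 0# (∈-con K.0#) (≈-sym (F.+-identityʳ _)))

  leading-∑ : ∀ {v} {A : Set} {a : A → K.Carrier} {f} (xs : List A) →
              (∀ {x} → x ∈ xs → Leading n v (a x) (f x)) → Leading n v (∑ᴷ K xs a) (∑ xs f)
  leading-∑ []       leads = lower⇒leading (∈-con K.0#)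
  leading-∑ (x ∷ xs) leads = leading-+ (leads (here refl)) (leading-∑ xs (leads ∘ there))

  Invertible : K.Carrier → Set (c ⊔ ℓ)
  Invertible = RightInvertible K._≈_ K.1# K._*_

  invertible-* : ∀ {a b} → Invertible a → Invertible b → Invertible (a K.* b)
  invertible-* (a⁻¹ , aa⁻¹≈1) (b⁻¹ , bb⁻¹≈1) = a⁻¹ K.* b⁻¹ ,
    K.trans (interchange K.*-commutativeSemigroup _ _ _ _)
      (K.trans (K.*-cong aa⁻¹≈1 bb⁻¹≈1) (K.*-identityˡ K.1#))

  cancel : ∀ {a b} → a K.* b K.≈ K.1# → ∀ (p : 𝕜⟨ I ⟩) → con a * (con b * p) ≈ p
  cancel {a = a} {b} ab≈1 p = begin
    con a * (con b * p) ≈⟨ *-assoc _ _ _ ⟨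
    con a * con b * p   ≈⟨ *-cong (con-* a b) ≈-refl ⟨
    con (a K.* b) * p   ≈⟨ *-cong (con-cong ab≈1) ≈-refl ⟩
    1# * p              ≈⟨ *-identityˡ p ⟩
    p                   ∎
    where open ≈-Reasoning

  -- Inverting a triangular substitution

  module Triangular (x : ℕ → 𝕜⟨ ℕ ⟩) (a : ℕ → K.Carrier) (invertible : ∀ n → Invertible (a n))
                    (leading : ∀ n → Leading n (var n) (a n) (x n)) where

    private
      a⁻¹ : ℕ → K.Carrier
      a⁻¹ = proj₁ ∘ invertible

      tail : ℕ → 𝕜⟨ ℕ ⟩
      tail = Leading.tail ∘ leading

      tail∈ : ∀ n → Lower n (tail n)
      tail∈ = Leading.tail∈ ∘ leading

      x≈ : ∀ n → x n ≈ con (a n) * var n + tail n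
      x≈ = Leading.p≈av+t ∘ leading

    solve : ∀ n → con (a⁻¹ n) * (x n + - tail n) ≈ var n
    solve n = begin
      con (a⁻¹ n) * (x n + - tail n)                      ≈⟨ *-cong ≈-refl (+-cong (x≈ n) ≈-refl) ⟩
      con (a⁻¹ n) * (con (a n) * var n + tail n + - tail n) ≈⟨ *-cong ≈-refl (+-assoc _ _ _) ⟩
      con (a⁻¹ n) * (con (a n) * var n + (tail n + - tail n))
        ≈⟨ *-cong ≈-refl (+-cong ≈-refl (F.-‿inverseʳ _)) ⟩
      con (a⁻¹ n) * (con (a n) * var n + 0#)              ≈⟨ *-cong ≈-refl (F.+-identityʳ _) ⟩
      con (a⁻¹ n) * (con (a n) * var n)
        ≈⟨ cancel (K.trans (K.*-comm _ _) (proj₂ (invertible n))) _ ⟩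
      var n                                               ∎
      where open ≈-Reasoning

    -- Strong induction: the variables below `n` are already in the subalgebra, hence so is
    -- `tail n`, and `solve` yields `var n`.
    generates : Generates x
    generates = vars∈⇒generates (<-rec _ λ n rec →
      ∈-resp (solve n) (∈-* (∈-con (a⁻¹ n)) (∈-+ (∈-generator n)
        (∈-neg (∈-trans (λ (m , m<n) → rec m<n) (tail∈ n))))))

    -- inverses n agrees with the inverse substitution below n.
    inverses : ℕ → ℕ → 𝕜⟨ ℕ ⟩
    inverses zero    m = 0#
    inverses (suc n) m with m ℕ.<? n
    ... | yes _ = inverses n m
    ... | no _  = con (a⁻¹ n) * (var n + - (tail n [ inverses n ]))

    -- Defining `inv n` directly from the values below `n` is not visibly well-founded: as an
    -- expression `tail n` may mention any variable, and only up to `≈` does it lie in `Lower n`.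
    -- The stages of `inverses` supply a total substitution instead.
    inv : ℕ → 𝕜⟨ ℕ ⟩
    inv n = inverses (suc n) n

    inv-≡ : ∀ n → inv n ≡ con (a⁻¹ n) * (var n + - (tail n [ inverses n ]))
    inv-≡ n with n ℕ.<? n
    ... | yes n<n = contradiction n<n (ℕ.<-irrefl refl)
    ... | no _    = refl

    -- The entry at `m` is fixed at stage m + 1 and copied by all later stages. Entries of
    -- `inverses n` at or beyond `n` are placeholders.
    inverses-stable : ∀ n {m} → m < n → inverses n m ≡ inv m
    inverses-stable (suc n) {m} m<1+n with m ℕ.<? n
    ... | yes m<n = inverses-stable n m<n
    ... | no m≮n with refl ← ℕ.≤-antisym (ℕ.s≤s⁻¹ m<1+n) (ℕ.≮⇒≥ m≮n) = sym (inv-≡ n)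

    -- `inv n` was built with the tail evaluated at `inverses n`, whereas here it is evaluated at
    -- `inv`. The values agree because `tail n` lies in `Lower n`, and so the tails cancel.
    x[inv]≈var : ∀ n → x n [ inv ] ≈ var n
    x[inv]≈var n = begin
      x n [ inv ]                                  ≈⟨ []-congˡ (x≈ n) ⟩
      con (a n) * inv n + tail n [ inv ]
        ≡⟨ cong (λ y → con (a n) * y + tail n [ inv ]) (inv-≡ n) ⟩
      con (a n) * (con (a⁻¹ n) * (var n + - t)) + tail n [ inv ]
        ≈⟨ +-cong (cancel (proj₂ (invertible n)) _) (≈-sym ([]-cong-∈ stable (tail∈ n))) ⟩
      (var n + - t) + t                            ≈⟨ +-assoc _ _ _ ⟩
      var n + (- t + t)                            ≈⟨ +-cong ≈-refl (-‿inverseˡ _) ⟩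
      var n + 0#                                   ≈⟨ F.+-identityʳ _ ⟩
      var n                                        ∎
      where
      open ≈-Reasoning
      t = tail n [ inverses n ]
      stable : ∀ ((m , _) : ∃ (_< n)) → inverses n m ≈ inv m
      stable (m , m<n) = F.reflexive (inverses-stable n m<n)

    independent : AlgebraicallyIndependent x
    independent = invertible⇒independent inv x[inv]≈var

-- The leading terms of R, Ψ and 𝐗

-- Only the one-part composition contributes the top generator. The enumeration puts it last, so a
-- sum over coarsenings splits off its final term.
EndsWith : ℕ → List Composition → Set
EndsWith n αs = ∃ λ βs → αs ≡ βs ++ ((suc n ∷ []) ∷ []) × All (All (_≤ n)) βs

-- Stated for any f with the values of the step in the definition of
-- compositions, which is local there.
endsWith-concatMap : (f : Composition → List Composition) →
  f [] ≡ (1 ∷ []) ∷ [] → (∀ a α → f (a ∷ α) ≡ (1 ∷ a ∷ α) ∷ (suc a ∷ α) ∷ []) →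
  ∀ {n αs} → EndsWith n αs → EndsWith (suc n) (concatMap f αs)
endsWith-concatMap f f-[] f-∷ {n} (βs , refl , βs≤) =
  concatMap f βs ++ ((1 ∷ suc n ∷ []) ∷ []) ,
  trans (concatMap-++ f βs _)
    (trans (cong (λ γs → concatMap f βs ++ γs ++ []) (f-∷ (suc n) []))
           (sym (++-assoc (concatMap f βs) _ _))) ,
  All.++⁺ (All.concat⁺ (All.map⁺ (All.map (step≤ _) βs≤))) ((s≤s z≤n ∷ ℕ.≤-refl ∷ []) ∷ [])
  where
  step≤ : ∀ β → All (_≤ n) β → All (All (_≤ suc n)) (f β)
  step≤ []      []          rewrite f-[]     = (s≤s z≤n ∷ []) ∷ []
  step≤ (b ∷ β) (b≤n ∷ β≤n) rewrite f-∷ b β =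
    (s≤s z≤n ∷ ℕ.m≤n⇒m≤1+n b≤n ∷ weaken) ∷ (s≤s b≤n ∷ weaken) ∷ []
    where weaken = All.map ℕ.m≤n⇒m≤1+n β≤n

-- From the final `suc n ∷ []` the step makes (1, n + 1) and then (n + 2): the second stays last,
-- the first joins the bounded ones.
compositions-endsWith : ∀ n → EndsWith n (compositions (suc n))
compositions-endsWith zero    = [] , refl , []
compositions-endsWith (suc n) =
  endsWith-concatMap _ refl (λ _ _ → refl) (compositions-endsWith n)

sum-hook : ∀ {i} → i ≤ n → sum (replicate i 1 ++ (n ∸ i) ∷ []) ≡ n
sum-hook {n}     z≤n       = ℕ.+-identityʳ n
sum-hook {suc n} (s≤s i≤n) = cong suc (sum-hook i≤n)

length-hook : ∀ i k → length (replicate i 1 ++ k ∷ []) ∸ 1 ≡ i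
length-hook zero    k = refl
length-hook (suc i) k = trans (length-++ (replicate i 1))
  (trans (ℕ.+-comm _ 1) (cong suc (length-replicate i)))

deduplicate-constant : ∀ (_≟_ : ∀ (x y : A) → Dec (x ≡ y)) {x y} ys → All (_≡ x) (y ∷ ys) →
                       deduplicate _≟_ (y ∷ ys) ≡ x ∷ []
deduplicate-constant _≟_ {x} ys (refl ∷ ys≡x) = cong (x ∷_) (filter-none _
  (All.deduplicate⁺ _≟_ (All.map (λ y≡x x≢y → x≢y (sym y≡x)) ys≡x)))

-- Component sizes of spanning and nonspanning sets of arcs

module _ (D : Digraph (suc n)) (S : List (Arc (suc n))) where

  open Data.List.Sort (⊵-decTotalOrder D) using (sort; sort-↭)

  private
    component : Fin (suc n) → VertexSet (suc n)
    component v = filter (joined? S v) (allFin (suc n))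

  -- All vertices have the same component, so the repeated copies collapse to one, and sorting a
  -- singleton leaves it fixed.
  α-spanning : Spanning S → α D S ≡ suc n ∷ []
  α-spanning spans = trans
    (cong (map length) (trans (cong sort components≡) (↭-singleton-inv (sort-↭ (allFin _ ∷ [])))))
    (cong (_∷ []) (length-tabulate {n = suc n} (λ v → v)))
    where
    component≡ : ∀ v → component v ≡ allFin (suc n)
    component≡ v = filter-all (joined? S v) (All.tabulate λ {w} _ → spans v w)

    components≡ : components S ≡ allFin (suc n) ∷ []
    components≡ = deduplicate-constant (≡-dec Fin._≟_) (map component (tabulate suc))
                    (All.map⁺ {f = component} (All.universal component≡ (allFin _)))

  -- A vertex joined to all others would join any two through itself, so every component misses a
  -- vertex. Sorting only permutes, so the bound survives.
  α-nonspanning : ¬ Spanning S → All (_≤ n) (α D S)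
  α-nonspanning ¬spans = All.map⁺ (All-resp-↭ (↭-sym (sort-↭ _)) components≤)
    where
    component< : ∀ v → length (component v) < suc n
    component< v with Fin.all? (joined? S v)
    ... | yes joined = ⊥-elim (¬spans λ x y → symmetric _ (joined x) ◅◅ joined y)
    ... | no ¬joined with w , v≁w ← Fin.¬∀⟶∃¬ _ _ (joined? S v) ¬joined =
      subst (length (component v) <_) (length-tabulate {n = suc n} (λ v → v))
        (filter-notAll (joined? S v) _ (lose (∈-allFin w) v≁w))

    components≤ : All (λ C → length C ≤ n) (components S)
    components≤ = All.deduplicate⁺ (≡-dec Fin._≟_)
      (All.map⁺ {f = component} (All.universal (ℕ.s≤s⁻¹ ∘ component<) (allFin _)))

module _ (K : Field c ℓ) where

  open FreeAlgebra K
  open NSymmetric K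
  private module K = Field K
  open Algebra.Properties.Ring K.ring using (-1*x≈-x; -‿involutive)
  open Algebra.Properties.Semiring.Exp K.semiring using (_^_)
  open Algebra.Properties.Semiring.Mult K.semiring using (×-cong) renaming (_×_ to _·_)

  sign-involutive : ∀ n → (K.- K.1#) ^ n K.* (K.- K.1#) ^ n K.≈ K.1#
  sign-involutive zero    = K.*-identityˡ K.1#
  sign-involutive (suc n) = K.trans (interchange K.*-commutativeSemigroup _ _ _ _)
    (K.trans (K.*-cong (K.trans (-1*x≈-x _) (-‿involutive _)) (sign-involutive n))
             (K.*-identityˡ K.1#))

  ∑ᴷ-const : ∀ (xs : List A) {a} → ∑ᴷ K xs (λ _ → a) ≡ length xs · a
  ∑ᴷ-const []       = refl
  ∑ᴷ-const (x ∷ xs) = cong (_ K.+_) (∑ᴷ-const xs)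

  ∑-++ : ∀ (xs ys : List A) (f : A → 𝕜⟨ I ⟩) → ∑ (xs ++ ys) f ≈ ∑ xs f + ∑ ys f
  ∑-++ []       ys f = ≈-sym (+-identityˡ _)
  ∑-++ (x ∷ xs) ys f = ≈-trans (+-cong ≈-refl (∑-++ xs ys f)) (≈-sym (+-assoc _ _ _))

  ∏-singleton-leading : ∀ (f : A → 𝕜⟨ ℕ ⟩) {x xs} → xs ≡ x ∷ [] →
                        Leading K n (f x) K.1# (∏ xs f)
  ∏-singleton-leading f {x} refl =
    leading-resp K (≈-sym (Ring.*-identityʳ (ring ℕ) (f x))) (leading-self K)

  H-lower : m ≤ n → Lower K n (H m)
  H-lower {zero}  _   = ∈-con K.1#
  H-lower {suc m} m<n = ∈-generator (m , m<n)

  -- Every coarsening except the one-part composition has parts at most `n`, so its product of `H`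
  -- is lower.
  R-leading : ∀ α → sum α ≡ suc n → Leading K n (var n) ((K.- K.1#) ^ (length α ∸ 1)) (R α)
  R-leading {n} α sum≡ with βs , eq , βs≤ ← compositions-endsWith n =
    leading-cong K (K.trans (K.+-identityˡ _) (K.trans (K.+-identityʳ _) (K.*-identityʳ _)))
      (leading-resp K (≈-trans (≈-sym (∑-++ (filter P? βs) _ term))
                               (Ring.reflexive (ring ℕ) (cong (λ γs → ∑ γs term) (sym split))))
        (leading-+ K
          (lower⇒leading K (∈-∑ K (All.map lower (All.filter⁺ P? βs≤))))
          (leading-+ K
            (leading-scale K _ (∏-singleton-leading H refl))
            (lower⇒leading K (∈-con K.0#)))))
    where
    P? = λ β → _⊆?_ ℕ._≟_ (partialSums β) (partialSums α)

    term : Composition → NSym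
    term β = [-1]^ (length α ∸ length β) · ∏ β H

    lower : ∀ {β} → All (_≤ n) β → Lower K n (term β)
    lower β≤ = ∈-* (∈-con _) (∈-∏ K (All.map H-lower β≤))

    split : coarsenings α ≡ filter P? βs ++ ((suc n ∷ []) ∷ [])
    split = trans (cong (filter P?) (trans (cong compositions sum≡) eq))
      -- `partialSums (suc n ∷ [])` is empty, so the one-part composition is coarser than every `α`.
      (trans (filter-++ P? βs _) (cong (filter P? βs ++_) (filter-accept P? {xs = []} λ ())))

  -- For each of the n + 1 hooks the sign (-1)^i in `Ψ` meets the same sign from `R-leading`, so
  -- each contributes 1.
  Ψ-leading : ∀ n → Leading K n (var n) (suc n · K.1#) (Ψ (suc n))
  Ψ-leading n = leading-cong K
    (K.trans (K.reflexive (∑ᴷ-const (upTo (suc n))))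
             (×-cong (length-upTo (suc n)) K.refl))
    (leading-∑ K (upTo (suc n)) λ {i} i∈ →
      leading-cong K (sign-involutive i) (leading-scale K _
        (subst (λ k → Leading K n (var n) ((K.- K.1#) ^ k) (R (hook i)))
          (length-hook i (suc n ∸ i))
          (R-leading (hook i) (sum-hook (ℕ.<⇒≤ (∈-upTo⁻ i∈)))))))
    where
    hook : ℕ → Composition
    hook i = replicate i 1 ++ (suc n ∸ i) ∷ []

  Ψ-lower : m ≤ n → Lower K n (Ψ m)
  -- The empty sum. It has to be covered since `Composition` does not record that parts are
  -- positive.
  Ψ-lower {zero}  _   = ∈-con K.0#
  Ψ-lower {suc m} m<n =
    lower-mono K m<n (leading⇒lower K (Ψ-leading m)
                       (∈-generator (m , ℕ.n<1+n m)) (ℕ.n≤1+n m))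

  -- For spanning `S` the product is the single factor `Ψ (suc n)`; otherwise all indices are at
  -- most `n` and the product is lower.
  𝐗-leading : ∀ (D : Digraph (suc n)) →
              Leading K n (Ψ (suc n)) (alternatingSum K spanningᵇ (arcs D)) (𝐗 K D)
  𝐗-leading {n} D = leading-∑ K (sublists (arcs D)) λ {S} _ → term S (spanning? S)
    where
    -- The decision is an argument so that matching on it evaluates the `if` inside `signed`.
    term : ∀ S (spans? : Dec (Spanning S)) →
           Leading K n (Ψ (suc n)) (if does spans? then (K.- K.1#) ^ length S else K.0#)
                   ([-1]^ (length S) · ∏ (α D S) Ψ)
    term S (no ¬spans) = lower⇒leading K (∈-* (∈-con _)
      (∈-∏ K (All.map Ψ-lower (α-nonspanning D S ¬spans))))
    term S (yes spans) = leading-cong K (K.*-identityʳ _)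
      (leading-scale K {v = Ψ (suc n)} _ (∏-singleton-leading Ψ (α-spanning D S spans)))

  -- Invertibility of the leading coefficients

  module _ (char0 : CharacteristicZero K) where

    -- Characteristic zero enters here, both for the coefficient of `var n` in `Ψ (suc n)` and for
    -- the count `N` of `signedCount`.
    suc·1-invertible : ∀ k → Invertible K (suc k · K.1#)
    suc·1-invertible k with b , _ , eq ← K.inverse _ (char0 k) = b , eq

    -- The sum is a sign, which is its own inverse, times `N · 1#`. Connectedness and looplessness
    -- of `D` make `N` positive.
    alternatingSum-invertible : ∀ (D : Digraph (suc n)) → Connected D →
                                Invertible K (alternatingSum K spanningᵇ (arcs D))
    alternatingSum-invertible {n} D connected
      with N , eq , pos ← signedCount K (arcs D) = invertible N (pos spans loopless) eq
      where
      open Digraph D using (_⟶?_)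

      spans : Spanning (arcs D)
      spans u v = gfold (isEquivalence _) (λ w → w)
        (λ a⟶b → return (∈-filter⁺ (λ (u , v) → u ⟶? v)
                   (∈-cartesianProduct⁺ (∈-allFin _) (∈-allFin _)) a⟶b))
        (connected u v)

      loopless : Loopless (arcs D)
      loopless ab∈ refl =
        Digraph.loopless D _ (proj₂ (∈-filter⁻ (λ (u , v) → u ⟶? v) ab∈))

      invertible : ∀ {a} N → 0 < N → a K.≈ (K.- K.1#) ^ n K.* (N · K.1#) → Invertible K a
      invertible (suc N) _ eq with b , eq′ ← invertible-* K (_ , sign-involutive n)
                                                             (suc·1-invertible N) =
        b , K.trans (K.*-congʳ eq) eq′

theorem4 : ∀ {c ℓ} (K : Field c ℓ) → CharacteristicZero K →
    (D : (i : ℕ) → Digraph (suc i)) → (∀ i → Connected (D i)) →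
    FreeAlgebra.Generates K (λ i → 𝐗 K (D i)) ×
    FreeAlgebra.AlgebraicallyIndependent K (λ i → 𝐗 K (D i))
theorem4 K char0 D connected = T.generates , T.independent
  where
  -- The diagonal coefficient, left to inference, is the alternating sum times i + 1: expand `𝐗` in
  -- `Ψ (suc i)`, then that in `var i`.
  module T = Triangular K (λ i → 𝐗 K (D i)) _
    (λ i → invertible-* K (alternatingSum-invertible K char0 (D i) (connected i))
                          (suc·1-invertible K char0 i))
    (λ i → leading-trans K (𝐗-leading K (D i)) (Ψ-leading K i))
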